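{- For every ordinal $\alpha$: $\alpha$ is the ordinal height of some automatic well-founded partial order if and only if $\alpha<\omega^\omega$.
   Context: Automatic structures: for a finite alphabet $\Sigma$ and a padding symbol $\diamond\notin\Sigma$, the convolution of a tuple $(w_1,\dots,w_n)$ of words over $\Sigma$ is the word of length $\max_i|w_i|$ over the alphabet $(\Sigma\cup\{\diamond\})^n$ whose $k$-th letter is $(\sigma_1,\dots,\sigma_n)$, where $\sigma_i$ is the $k$-th letter of $w_i$ if $k\le |w_i|$ and $\diamond$ otherwise. An $n$-ary relation on $\Sigma^\star$ is regular if the set of convolutions of its tuples is accepted by a finite automaton. A structure $(A;R_1,\dots,R_m)$ with finitely many relations is automatic over $\Sigma$ if $A\subseteq\Sigma^\star$ is a regular language and each $R_i$ is a regular relation; a structure is called automatic if it is isomorphic to such a structure. Ordinal height: for a well-founded binary relation $R$ on $A$ (no infinite sequence $x_1,x_2,\dots$ with $(x_{i+1},x_i)\in R$ for all $i$), define $r_{\mathcal A}(x)=0$ for $R$-minimal $x$ and $r_{\mathcal A}(z)=\sup\{r_{\mathcal A}(y)+1:(y,z)\in R\}$ otherwise; the ordinal height of $(A;R)$ is $r(\mathcal A)=\sup\{r_{\mathcal A}(x):x\in A\}$. For a partial order $\le$, the relevant relation is the strict order $<$. -}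

module Defs where

open import Data.Nat using (ℕ; zero; suc)
open import Data.Fin using (Fin)
open import Data.Bool using (Bool; true)
open import Data.List using (List; []; _∷_; foldl)
open import Data.Maybe using (Maybe; just; nothing)
open import Data.Product using (Σ; ∃; _×_; _,_; proj₁)
open import Data.Sum using (_⊎_; inj₁; inj₂)
open import Data.Empty using (⊥; ⊥-elim)
open import Data.Unit using (⊤)
open import Relation.Nullary using (¬_)
open import Relation.Binary.PropositionalEquality using (_≡_)
open import Induction.WellFounded using (Acc; acc; WellFounded)

record DFA (A : Set) : Set where
  field
    nStates : ℕ
    start   : Fin nStates
    δ       : Fin nStates → A → Fin nStates
    final   : Fin nStates → Bool

Accepts : {A : Set} → DFA A → List A → Set
Accepts D w = DFA.final D (foldl (DFA.δ D) (DFA.start D) w) ≡ true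

-- Padded alphabet: nothing plays the role of the padding symbol ◇.
Padded : ℕ → Set
Padded k = Maybe (Fin k)

conv : {k : ℕ} → List (Fin k) → List (Fin k) → List (Padded k × Padded k)
conv []      []      = []
conv (a ∷ u) []      = (just a , nothing) ∷ conv u []
conv []      (b ∷ v) = (nothing , just b) ∷ conv [] v
conv (a ∷ u) (b ∷ v) = (just a , just b) ∷ conv u v

-- sup I f denotes the least ordinal strictly above every f i.
data Ord : Set₁ where
  sup : (I : Set) → (I → Ord) → Ord

mutual
  _≤ₒ_ : Ord → Ord → Set
  sup I f ≤ₒ β = (i : I) → f i <ₒ β

  _<ₒ_ : Ord → Ord → Set
  α <ₒ sup J g = Σ J (λ j → α ≤ₒ g j)

_≈ₒ_ : Ord → Ord → Set
α ≈ₒ β = (α ≤ₒ β) × (β ≤ₒ α)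

infix 4 _≤ₒ_ _<ₒ_ _≈ₒ_

zeroₒ : Ord
zeroₒ = sup ⊥ ⊥-elim

_+ₒ_ : Ord → Ord → Ord
sup J g +ₒ sup I f = sup (J ⊎ I) h
  where
    h : J ⊎ I → Ord
    h (inj₁ j) = g j
    h (inj₂ i) = sup J g +ₒ f i

_·ℕ_ : Ord → ℕ → Ord
α ·ℕ zero  = zeroₒ
α ·ℕ suc k = (α ·ℕ k) +ₒ α

ω^ : ℕ → Ord
ω^ zero    = sup ⊤ (λ _ → zeroₒ)
ω^ (suc n) = sup ℕ (λ k → ω^ n ·ℕ k)

ω^ω : Ord
ω^ω = sup ℕ ω^

module Height {D : Set} (_<_ : D → D → Set) (wf : WellFounded _<_) where

  rankAcc : (x : D) → Acc _<_ x → Ord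
  rankAcc x (acc rs) = sup (Σ D (λ y → y < x)) (λ p → rankAcc (proj₁ p) (rs (Data.Product.proj₂ p)))

  rank : D → Ord
  rank x = rankAcc x (wf x)

  -- r(A) = sup { r(x) : x ∈ A } = sup { r(y) + 1 : y < x, x ∈ A }
  height : Ord
  height = sup (Σ D (λ x → Σ D (λ y → y < x))) (λ p → rank (proj₁ (Data.Product.proj₂ p)))

record AutomaticWFPO : Set where
  field
    k    : ℕ
    Dom  : DFA (Fin k)
    Ord≤ : DFA (Padded k × Padded k)

  Carrier : Set
  Carrier = Σ (List (Fin k)) (Accepts Dom)

  _≤_ : Carrier → Carrier → Set
  x ≤ y = Accepts Ord≤ (conv (proj₁ x) (proj₁ y))

  _<_ : Carrier → Carrier → Set
  x < y = (x ≤ y) × ¬ (proj₁ x ≡ proj₁ y)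

  field
    refl≤    : ∀ x → x ≤ x
    antisym≤ : ∀ x y → x ≤ y → y ≤ x → proj₁ x ≡ proj₁ y
    trans≤   : ∀ x y z → x ≤ y → y ≤ z → x ≤ z
    wf<      : WellFounded _<_

  height : Ord
  height = Height.height _<_ wf<

{-# OPTIONS --safe #-}
module Submission where

-- By Cantor normal form, the ordinals below ωⁿ are the vectors in ℕⁿ, ordered lexicographically.
--
-- Every d ∈ ℕⁿ is the height of an automatic linear order: encoding a₁ ∷ a₂ ∷ … as the binary word
-- 1^a₁ 0 1^a₂ 0 … turns the lexicographic order of vectors into that of words, and the codes of
-- {v : v ≼ d} form a regular language.
--
-- Conversely, for u in an automatic well-founded partial order, {x : x < u} is the union of
-- finitely many singletons and of the pieces {v w : v w < u, w nonempty} for |v| = |u|. The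
-- isomorphism type of a piece is determined by the states reached by the automata after reading
-- v, (v,u) and (v,v). There are finitely many such triples, so there is an M such that every piece
-- that embeds in some ωᵐ embeds in ω^M. By well-founded induction all ranks are below ω^(M+1): if
-- this holds below u, then all pieces embed in ω^(M+1), hence in ω^M, and the rank of u is at most
-- the natural sum of the heights of the finitely many pieces, all at most ω^M.

open import Defs
open import Level using (0ℓ; Lift; lift; lower)
open import Data.Product using (Σ; ∃; _×_; _,_; proj₁; proj₂; -,_)
open import Function.Bundles using (_⇔_)
open import Axiom.ExcludedMiddle using (ExcludedMiddle)

open import Data.Bool using (Bool; true; false; _∧_)
open import Data.Bool.Properties using (∧-conicalˡ; ∧-conicalʳ)
open import Data.Empty using (⊥; ⊥-elim)
open import Data.Fin as Fin using (Fin; zero; suc)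
open import Data.Fin.Patterns using (0F; 1F)
open import Data.Fin.Properties as Fin using (*↔×; +↔⊎; 2↔Bool)
open import Data.List using (List; []; _∷_; [_]; _++_; foldl; length; tabulate)
open import Data.List.Extrema.Nat using (max; xs≤max)
open import Data.List.Membership.Propositional.Properties using (∈-tabulate⁺)
open import Data.List.Properties
  using (foldl-++; ++-assoc; ++-identityʳ; ++-cancelˡ; length-++; ∷-injectiveʳ)
open import Data.List.Relation.Binary.Lex.Strict as ListLex using (base; halt; this; next)
open import Data.List.Relation.Binary.Pointwise as ListPointwise using ()
open import Data.List.Relation.Unary.All as All using ()
open import Data.Maybe using (Maybe; just; nothing; fromMaybe; maybe′)
open import Data.Nat
  using (ℕ; zero; suc; pred; _+_; _*_; _<_; _≤_; z≤n; s≤s; _≤′_; ≤′-refl; ≤′-step)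
open import Data.Nat.Induction using (<-wellFounded)
open import Data.Nat.Properties as ℕ using ()
open import Data.Product.Function.NonDependent.Propositional using (_×-↔_)
open import Data.Sum using (_⊎_; inj₁; inj₂)
open import Data.Sum.Function.Propositional using (_⊎-↔_)
open import Data.Unit using (⊤; tt)
open import Data.Vec using (Vec; []; _∷_; replicate; zipWith)
open import Data.Vec.Relation.Binary.Lex.Core as VecLex using (base; this; next)
open import Data.Vec.Relation.Binary.Lex.Strict as VecLex using ()
open import Data.Vec.Relation.Binary.Pointwise.Inductive as VecPointwise using ()
open import Function using (_∘_; id; _on_; _↔_; mk⇔; mk↔ₛ′; Equivalence; Inverse)
open import Function.Construct.Composition using (_↔-∘_; _⇔-∘_)
open import Function.Construct.Identity using (↔-id)
open import Function.Related.Propositional using (≡⇒)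
open import Induction.WellFounded as WF using (Acc; acc; WellFounded)
open import Relation.Binary
  using (Rel; Transitive; Asymmetric; Trichotomous; _Respects₂_; IsEquivalence; IsPreorder;
         IsPartialOrder; tri<; tri≈; tri>)
open import Relation.Binary.Construct.On as On using ()
open import Relation.Binary.PropositionalEquality
  using (_≡_; _≢_; refl; sym; trans; cong; cong₂; subst; subst₂; module ≡-Reasoning)
open import Relation.Binary.PropositionalEquality.Properties using (isEquivalence)
open import Relation.Nullary using (¬_; yes; no)
open import Relation.Nullary.Decidable using (map′; decidable-stable)
open import Relation.Unary using (Pred; _⊆_; _∪_; _∩_; ⋃)

-- Ordinals

≤ₒ-refl : ∀ {α} → α ≤ₒ α
≤ₒ-refl {sup I f} i = i , ≤ₒ-refl {f i}

mutual
  ≤ₒ-trans : ∀ {α β γ} → α ≤ₒ β → β ≤ₒ γ → α ≤ₒ γ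
  ≤ₒ-trans {sup I f} α≤β β≤γ i = <ₒ-≤ₒ-trans (α≤β i) β≤γ

  <ₒ-≤ₒ-trans : ∀ {α β γ} → α <ₒ β → β ≤ₒ γ → α <ₒ γ
  <ₒ-≤ₒ-trans {β = sup J g} (j , α≤gj) β≤γ = ≤ₒ-<ₒ-trans α≤gj (β≤γ j)

  ≤ₒ-<ₒ-trans : ∀ {α β γ} → α ≤ₒ β → β <ₒ γ → α <ₒ γ
  ≤ₒ-<ₒ-trans {γ = sup K h} α≤β (k , β≤hk) = k , ≤ₒ-trans α≤β β≤hk

<ₒ⇒≤ₒ : ∀ {α β} → α <ₒ β → α ≤ₒ β
<ₒ⇒≤ₒ {sup I f} {sup J g} (j , α≤gj) i = j , <ₒ⇒≤ₒ (α≤gj i)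

<ₒ-trans : ∀ {α β γ} → α <ₒ β → β <ₒ γ → α <ₒ γ
<ₒ-trans α<β β<γ = <ₒ-≤ₒ-trans α<β (<ₒ⇒≤ₒ β<γ)

<ₒ-irrefl : ∀ {α} → ¬ α <ₒ α
<ₒ-irrefl {sup I f} (i , α≤fi) = <ₒ-irrefl {f i} (α≤fi i)

≤ₒ-ext : ∀ {α β} → (∀ {γ} → γ <ₒ α → γ <ₒ β) → α ≤ₒ β
≤ₒ-ext {sup I f} <α⇒<β i = <α⇒<β (i , ≤ₒ-refl)

≈ₒ-isEquivalence : IsEquivalence _≈ₒ_
≈ₒ-isEquivalence = record
  { refl  = ≤ₒ-refl , ≤ₒ-refl
  ; sym   = λ (α≤β , β≤α) → β≤α , α≤β
  ; trans = λ (α≤β , β≤α) (β≤γ , γ≤β) → ≤ₒ-trans α≤β β≤γ , ≤ₒ-trans γ≤β β≤α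
  }

module ≈ₒ = IsEquivalence ≈ₒ-isEquivalence

≤ₒ-isPreorder : IsPreorder _≈ₒ_ _≤ₒ_
≤ₒ-isPreorder = record { isEquivalence = ≈ₒ-isEquivalence ; reflexive = proj₁ ; trans = ≤ₒ-trans }

<ₒ-asym : Asymmetric _<ₒ_
<ₒ-asym α<β β<α = <ₒ-irrefl (<ₒ-trans α<β β<α)

<ₒ-resp-≈ₒ : _<ₒ_ Respects₂ _≈ₒ_
<ₒ-resp-≈ₒ = (λ (β≤γ , _) α<β → <ₒ-≤ₒ-trans α<β β≤γ) , (λ (_ , γ≤β) β<α → ≤ₒ-<ₒ-trans γ≤β β<α)

module ≤ₒ-Reasoning where
  open import Relation.Binary.Reasoning.Base.Triple
    ≤ₒ-isPreorder <ₒ-asym <ₒ-trans <ₒ-resp-≈ₒ <ₒ⇒≤ₒ <ₒ-≤ₒ-trans ≤ₒ-<ₒ-trans public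

α≤α+β : ∀ α β → α ≤ₒ α +ₒ β
α≤α+β (sup J g) (sup I f) j = inj₁ j , ≤ₒ-refl

β≤α+β : ∀ α β → β ≤ₒ α +ₒ β
β≤α+β α@(sup _ _) (sup I f) i = inj₂ i , β≤α+β α (f i)

mutual
  +ₒ-monoʳ-≤ : ∀ α {β γ} → β ≤ₒ γ → α +ₒ β ≤ₒ α +ₒ γ
  +ₒ-monoʳ-≤ α@(sup _ _) {sup _ _} {sup _ _} β≤γ (inj₁ j) = inj₁ j , ≤ₒ-refl
  +ₒ-monoʳ-≤ α@(sup _ _) {sup _ _}           β≤γ (inj₂ i) = +ₒ-monoʳ-< α (β≤γ i)

  +ₒ-monoʳ-< : ∀ α {β γ} → β <ₒ γ → α +ₒ β <ₒ α +ₒ γ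
  +ₒ-monoʳ-< α@(sup _ _) {γ = sup _ _} (k , β≤hk) = inj₂ k , +ₒ-monoʳ-≤ α β≤hk

<-+ₒ-split : ∀ {α} β γ → α <ₒ β +ₒ γ → α <ₒ β ⊎ ∃ λ δ → δ <ₒ γ × α ≤ₒ β +ₒ δ
<-+ₒ-split (sup _ _) (sup _ _) (inj₁ j , α≤gj)   = inj₁ (j , α≤gj)
<-+ₒ-split (sup _ _) (sup _ f) (inj₂ i , α≤β+fi) = inj₂ (f i , (i , ≤ₒ-refl) , α≤β+fi)

·ℕ-monoʳ-≤ : ∀ α {a b} → a ≤ b → α ·ℕ a ≤ₒ α ·ℕ b
·ℕ-monoʳ-≤ α = mono-≤′ ∘ ℕ.≤⇒≤′
  where
  mono-≤′ : ∀ {a b} → a ≤′ b → α ·ℕ a ≤ₒ α ·ℕ b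
  mono-≤′ ≤′-refl                   = ≤ₒ-refl
  mono-≤′ {b = suc b} (≤′-step a≤b) = ≤ₒ-trans (mono-≤′ a≤b) (α≤α+β (α ·ℕ b) α)

ω^n<ω^1+n : ∀ n → ω^ n <ₒ ω^ (suc n)
ω^n<ω^1+n n = 1 , β≤α+β zeroₒ (ω^ n)

ω^-mono-≤ : ∀ {m n} → m ≤ n → ω^ m ≤ₒ ω^ n
ω^-mono-≤ = mono-≤′ ∘ ℕ.≤⇒≤′
  where
  mono-≤′ : ∀ {m n} → m ≤′ n → ω^ m ≤ₒ ω^ n
  mono-≤′ ≤′-refl                   = ≤ₒ-refl
  mono-≤′ {n = suc n} (≤′-step m≤n) = ≤ₒ-trans (mono-≤′ m≤n) (<ₒ⇒≤ₒ (ω^n<ω^1+n n))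

-- Cantor normal forms

infix 4 _≺_ _≼_

Lex : Set → ∀ {n} → Rel (Vec ℕ n) 0ℓ
Lex P = VecLex.Lex {A = ℕ} P _≡_ _<_

_≺_ _≼_ : ∀ {n} → Rel (Vec ℕ n) 0ℓ
_≺_ = Lex ⊥
_≼_ = Lex ⊤

≺-wellFounded : ∀ {n} → WellFounded (_≺_ {n})
≺-wellFounded = VecLex.<-wellFounded trans (proj₁ ℕ.<-resp₂-≡) <-wellFounded

≺-or-≽ : ∀ {n} (u v : Vec ℕ n) → u ≺ v ⊎ v ≼ u
≺-or-≽ u v with VecLex.<-cmp sym ℕ.<-cmp u v
... | tri< u≺v _ _ = inj₁ u≺v
... | tri≈ _ u≋v _ = inj₂ (VecLex.≤-refl (VecPointwise.sym sym u≋v))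
... | tri> _ _ v≺u = inj₂ (VecLex.<⇒≤ v≺u)

⟦_⟧ : ∀ {n} → Vec ℕ n → Ord
⟦ [] ⟧              = zeroₒ
⟦_⟧ {suc n} (a ∷ v) = (ω^ n ·ℕ a) +ₒ ⟦ v ⟧

⟦⟧<ω^ : ∀ {n} (v : Vec ℕ n) → ⟦ v ⟧ <ₒ ω^ n
⟦⟧<ω^ []              = tt , λ ()
⟦⟧<ω^ {suc n} (a ∷ v) = suc a , +ₒ-monoʳ-≤ (ω^ n ·ℕ a) (<ₒ⇒≤ₒ (⟦⟧<ω^ v))

⟦⟧-mono-< : ∀ {n} {u v : Vec ℕ n} → u ≺ v → ⟦ u ⟧ <ₒ ⟦ v ⟧
⟦⟧-mono-< {suc n} {a ∷ u} {b ∷ v} (this a<b _) = begin-strict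
  (ω^ n ·ℕ a) +ₒ ⟦ u ⟧ <⟨ +ₒ-monoʳ-< (ω^ n ·ℕ a) (⟦⟧<ω^ u) ⟩
  ω^ n ·ℕ suc a        ≤⟨ ·ℕ-monoʳ-≤ (ω^ n) a<b ⟩
  ω^ n ·ℕ b            ≤⟨ α≤α+β (ω^ n ·ℕ b) ⟦ v ⟧ ⟩
  (ω^ n ·ℕ b) +ₒ ⟦ v ⟧ ∎
  where open ≤ₒ-Reasoning
⟦⟧-mono-< {suc n} {a ∷ _} (next refl u≺v) = +ₒ-monoʳ-< (ω^ n ·ℕ a) (⟦⟧-mono-< u≺v)

⟦⟧-mono-≤ : ∀ {n} {u v : Vec ℕ n} → u ≼ v → ⟦ u ⟧ ≤ₒ ⟦ v ⟧
⟦⟧-mono-≤                         (base tt)       = ≤ₒ-refl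
⟦⟧-mono-≤ {suc n} {a ∷ u} {b ∷ v} (this a<b refl) =
  <ₒ⇒≤ₒ {⟦ a ∷ u ⟧} (⟦⟧-mono-< {u = a ∷ u} {b ∷ v} (this a<b refl))
⟦⟧-mono-≤ {suc n} {a ∷ u} {a ∷ v} (next refl u≼v) = +ₒ-monoʳ-≤ (ω^ n ·ℕ a) (⟦⟧-mono-≤ u≼v)

⟦⟧-cancel-< : ∀ {n} (u v : Vec ℕ n) → ⟦ u ⟧ <ₒ ⟦ v ⟧ → u ≺ v
⟦⟧-cancel-< u v ⟦u⟧<⟦v⟧ with ≺-or-≽ u v
... | inj₁ u≺v = u≺v
... | inj₂ v≼u = ⊥-elim (<ₒ-irrefl (<ₒ-≤ₒ-trans ⟦u⟧<⟦v⟧ (⟦⟧-mono-≤ v≼u)))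

⟦⟧-cancel-≤ : ∀ {n} (u v : Vec ℕ n) → ⟦ u ⟧ ≤ₒ ⟦ v ⟧ → u ≼ v
⟦⟧-cancel-≤ u v ⟦u⟧≤⟦v⟧ with ≺-or-≽ v u
... | inj₁ v≺u = ⊥-elim (<ₒ-irrefl (≤ₒ-<ₒ-trans ⟦u⟧≤⟦v⟧ (⟦⟧-mono-< v≺u)))
... | inj₂ u≼v = u≼v

mutual
  ω^-cofinal : ∀ n {α} → α <ₒ ω^ n → ∃ λ (v : Vec ℕ n) → α ≤ₒ ⟦ v ⟧
  ω^-cofinal zero    (tt , α≤0)   = [] , α≤0
  ω^-cofinal (suc n) (a , α≤ω^·a) =
    a ∷ replicate n 0 , ≤ₒ-trans α≤ω^·a (α≤α+β (ω^ n ·ℕ a) ⟦ replicate n 0 ⟧)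

  ω^·-cofinal : ∀ n a {α} → α <ₒ ω^ n ·ℕ a → ∃ λ b → b < a × ∃ λ (v : Vec ℕ n) → α ≤ₒ ⟦ b ∷ v ⟧
  ω^·-cofinal n (suc a) α<ω^·1+a with <-+ₒ-split (ω^ n ·ℕ a) (ω^ n) α<ω^·1+a
  ... | inj₁ α<ω^·a =
    let (b , b<a , v , α≤bv) = ω^·-cofinal n a α<ω^·a in b , ℕ.m<n⇒m<1+n b<a , v , α≤bv
  ... | inj₂ (γ , γ<ω^ , α≤ω^·a+γ) =
    let (v , γ≤v) = ω^-cofinal n γ<ω^ in
    a , ℕ.n<1+n a , v , ≤ₒ-trans α≤ω^·a+γ (+ₒ-monoʳ-≤ (ω^ n ·ℕ a) γ≤v)

⟦⟧-cofinal : ∀ {n} (v : Vec ℕ n) {α} → α <ₒ ⟦ v ⟧ → ∃ λ u → u ≺ v × α ≤ₒ ⟦ u ⟧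
⟦⟧-cofinal {suc n} (a ∷ v) α<av with <-+ₒ-split (ω^ n ·ℕ a) ⟦ v ⟧ α<av
... | inj₁ α<ω^·a =
  let (b , b<a , u , α≤bu) = ω^·-cofinal n a α<ω^·a in b ∷ u , this b<a refl , α≤bu
... | inj₂ (γ , γ<v , α≤ω^·a+γ) =
  let (u , u≺v , γ≤u) = ⟦⟧-cofinal v γ<v in
  a ∷ u , next refl u≺v , ≤ₒ-trans α≤ω^·a+γ (+ₒ-monoʳ-≤ (ω^ n ·ℕ a) γ≤u)

-- On coefficient vectors, the natural (Hessenberg) sum of ordinals is the pointwise one.
_⊕_ : ∀ {n} → Vec ℕ n → Vec ℕ n → Vec ℕ n
_⊕_ = zipWith _+_

⊕-mono : ∀ {P Q R : Set} → (P → Q → R) → ∀ {n} {u v w x : Vec ℕ n} →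
         Lex P u v → Lex Q w x → Lex R (u ⊕ w) (v ⊕ x)
⊕-mono f (base p)        (base q)        = base (f p q)
⊕-mono f (this a<b _)    (this c<d _)    = this (ℕ.+-mono-< a<b c<d) refl
⊕-mono f (this a<b _)    (next refl _)   = this (ℕ.+-monoˡ-< _ a<b) refl
⊕-mono f (next refl _)   (this c<d _)    = this (ℕ.+-monoʳ-< _ c<d) refl
⊕-mono f (next refl u<v) (next refl w<x) = next refl (⊕-mono f u<v w<x)

-- Ranks in well-founded relations

module RankProperties {A : Set} {_<_ : Rel A 0ℓ} (wf : WellFounded _<_) where

  open Height _<_ wf
  open WF.All wf 0ℓ using (wfRec)

  private
    rankAcc-irrelevant : ∀ {x} (p q : Acc _<_ x) → rankAcc x p ≤ₒ rankAcc x q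
    rankAcc-irrelevant (acc rs) (acc ss) (y , y<x) =
      (y , y<x) , rankAcc-irrelevant (rs y<x) (ss y<x)

  rank-mono : ∀ {y x} → y < x → rank y <ₒ rank x
  rank-mono {y} {x} y<x with wf x
  ... | acc rs = (y , y<x) , rankAcc-irrelevant (wf y) (rs y<x)

  rank-least : ∀ x {β} → (∀ {y} → y < x → rank y <ₒ β) → rank x ≤ₒ β
  rank-least x rank<β with wf x
  ... | acc rs = λ (y , y<x) → ≤ₒ-<ₒ-trans (rankAcc-irrelevant (rs y<x) (wf y)) (rank<β y<x)

  rank≤mono : {P : Pred A 0ℓ} (h : A → Ord) → (∀ {y x} → P x → y < x → P y × h y <ₒ h x) →
          ∀ {x} → P x → rank x ≤ₒ h x
  rank≤mono {P} h h-mono {x} = wfRec (λ x → P x → rank x ≤ₒ h x)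
    (λ x ih x∈P → rank-least x λ y<x →
      let (y∈P , hy<hx) = h-mono x∈P y<x in ≤ₒ-<ₒ-trans (ih y<x y∈P) hy<hx) x

  cofinal≤rank : (h : A → Ord) → (∀ x {γ} → γ <ₒ h x → ∃ λ y → y < x × γ ≤ₒ h y) →
                 ∀ x → h x ≤ₒ rank x
  cofinal≤rank h h-cofinal = wfRec (λ x → h x ≤ₒ rank x) λ x ih → ≤ₒ-ext λ γ<hx →
    let (y , y<x , γ≤hy) = h-cofinal x γ<hx in
    ≤ₒ-<ₒ-trans (≤ₒ-trans γ≤hy (ih y<x)) (rank-mono y<x)

  height≈rank-maximum : ∀ m → (∀ {y x} → y < x → y < m) → height ≈ₒ rank m
  height≈rank-maximum m <⇒<m =
    (λ (_ , y , y<x) → rank-mono (<⇒<m y<x)) , rank-least m λ y<m → (m , -, y<m) , ≤ₒ-refl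

record Embedding {A : Set} (_<_ : Rel A 0ℓ) (n : ℕ) : Set₁ where
  field
    ord      : A → Ord
    ord-mono : ∀ {y x} → y < x → ord y <ₒ ord x
    ord<ω^   : ∀ x → ord x <ₒ ω^ n

embedding-≤ : ∀ {A} {_<_ : Rel A 0ℓ} {m n} → m ≤ n → Embedding _<_ m → Embedding _<_ n
embedding-≤ m≤n e = record
  { ord = ord ; ord-mono = ord-mono ; ord<ω^ = λ x → <ₒ-≤ₒ-trans (ord<ω^ x) (ω^-mono-≤ m≤n) }
  where open Embedding e

embedding-∘ : ∀ {A B} {_<A_ : Rel A 0ℓ} {_<B_ : Rel B 0ℓ} {n} (f : B → A) →
              (∀ {y x} → y <B x → f y <A f x) → Embedding _<A_ n → Embedding _<B_ n
embedding-∘ f f-mono e = record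
  { ord = ord ∘ f ; ord-mono = ord-mono ∘ f-mono ; ord<ω^ = ord<ω^ ∘ f }
  where open Embedding e

-- The model is the function sending x to the height of {y ∈ X : y < x}, if these are below ωⁿ.
record Ranking {A : Set} (_<_ : Rel A 0ℓ) (n : ℕ) (X : Pred A 0ℓ) : Set where
  field
    coeffs   : A → Vec ℕ n
    coeffs-≼ : ∀ {y x} → y < x → coeffs y ≼ coeffs x
    coeffs-≺ : ∀ {y x} → X y → y < x → coeffs y ≺ coeffs x

module _ {A : Set} {_<_ : Rel A 0ℓ} where

  ranking-⊆ : ∀ {n} {X Y : Pred A 0ℓ} → X ⊆ Y → Ranking _<_ n Y → Ranking _<_ n X
  ranking-⊆ X⊆Y r = record { coeffs = coeffs ; coeffs-≼ = coeffs-≼ ; coeffs-≺ = coeffs-≺ ∘ X⊆Y }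
    where open Ranking r

  ranking-∪ : ∀ {n} {X Y : Pred A 0ℓ} → Ranking _<_ n X → Ranking _<_ n Y → Ranking _<_ n (X ∪ Y)
  ranking-∪ {n} {X} {Y} r s = record
    { coeffs   = λ x → R.coeffs x ⊕ S.coeffs x
    ; coeffs-≼ = λ y<x → ⊕-mono (λ _ _ → tt) (R.coeffs-≼ y<x) (S.coeffs-≼ y<x)
    ; coeffs-≺ = λ
      { (inj₁ y∈X) y<x → ⊕-mono (λ ()) (R.coeffs-≺ y∈X y<x) (S.coeffs-≼ y<x)
      ; (inj₂ y∈Y) y<x → ⊕-mono (λ _ ()) (R.coeffs-≼ y<x) (S.coeffs-≺ y∈Y y<x)
      }
    }
    where
    module R = Ranking r
    module S = Ranking s

  ranking-⋃ : ∀ {n k} {X : Fin k → Pred A 0ℓ} →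
              (∀ i → Ranking _<_ n (X i)) → Ranking _<_ n (⋃ (Fin k) X)
  ranking-⋃ {n} {zero}  r = record
    { coeffs   = λ _ → replicate n 0
    ; coeffs-≼ = λ _ → VecLex.≤-refl (VecPointwise.refl refl)
    ; coeffs-≺ = λ ()
    }
  ranking-⋃ {n} {suc k} r =
    ranking-⊆ (λ { (zero , x∈X₀) → inj₁ x∈X₀ ; (suc i , x∈Xᵢ) → inj₂ (i , x∈Xᵢ) })
              (ranking-∪ (r zero) (ranking-⋃ (r ∘ suc)))

  ranking⇒rank<ω^ : (wf : WellFounded _<_) → Transitive _<_ → ∀ {n X} → Ranking _<_ n X →
                    ∀ x → (_< x) ⊆ X → Height.rank _<_ wf x <ₒ ω^ n
  ranking⇒rank<ω^ wf <-trans {X = X} r x ↓x⊆X =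
    ≤ₒ-<ₒ-trans (rank≤mono (⟦_⟧ ∘ coeffs) coeffs-mono (λ {y} → ↓x⊆X {y})) (⟦⟧<ω^ (coeffs x))
    where
    open Ranking r
    open RankProperties wf using (rank≤mono)

    coeffs-mono : ∀ {z y} → (_< y) ⊆ X → z < y → (_< z) ⊆ X × ⟦ coeffs z ⟧ <ₒ ⟦ coeffs y ⟧
    coeffs-mono ↓y⊆X z<y = (λ w<z → ↓y⊆X (<-trans w<z z<y)) , ⟦⟧-mono-< (coeffs-≺ (↓y⊆X z<y) z<y)

-- Finite types

Finite : Set → Set
Finite A = ∃ λ n → Fin n ↔ A

Fin-finite : ∀ {n} → Finite (Fin n)
Fin-finite {n} = n , ↔-id (Fin n)

×-finite : ∀ {A B} → Finite A → Finite B → Finite (A × B)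
×-finite (m , Fin↔A) (n , Fin↔B) = m * n , (Fin↔A ×-↔ Fin↔B) ↔-∘ *↔×

⊎-finite : ∀ {A B} → Finite A → Finite B → Finite (A ⊎ B)
⊎-finite (m , Fin↔A) (n , Fin↔B) = m + n , (Fin↔A ⊎-↔ Fin↔B) ↔-∘ +↔⊎

Bool-finite : Finite Bool
Bool-finite = 2 , 2↔Bool

Maybe-finite : ∀ {A} → Finite A → Finite (Maybe A)
Maybe-finite {A} (n , Fin↔A) = suc n , mk↔ₛ′ to′ from′
  (λ { nothing → refl ; (just a) → cong just (strictlyInverseˡ a) })
  (λ { zero → refl ; (suc i) → cong suc (strictlyInverseʳ i) })
  where
  open Inverse Fin↔A

  to′ : Fin (suc n) → Maybe A
  to′ zero    = nothing
  to′ (suc i) = just (to i)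

  from′ : Maybe A → Fin (suc n)
  from′ = maybe′ (suc ∘ from) zero

-- Consequences of excluded middle

IsMinimal : ∀ {A : Set} → Rel A 0ℓ → Pred A 0ℓ → Pred A 0ℓ
IsMinimal _<_ P x = P x × ∀ {y} → y < x → ¬ P y

module Classical (em : ExcludedMiddle (Level.suc 0ℓ)) where

  em₀ : ExcludedMiddle 0ℓ
  em₀ {P} = map′ lower lift (em {Lift _ P})

  ≰ₒ⇒>ₒ : ∀ {α β} → ¬ α ≤ₒ β → β <ₒ α
  ≰ₒ⇒>ₒ {sup I f} {sup J g} α≰β = decidable-stable em₀ λ β≮α →
    α≰β λ i → decidable-stable em₀ λ fi≮β →
      β≮α (i , λ j → ≰ₒ⇒>ₒ λ fi≤gj → fi≮β (j , fi≤gj))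

  minimal : ∀ {A} {_<_ : Rel A 0ℓ} → WellFounded _<_ → ∀ P → ∃ P → ∃ (IsMinimal _<_ P)
  minimal {_<_ = _<_} wf P (x , x∈P) = wfRec (λ x → P x → ∃ (IsMinimal _<_ P)) descend x x∈P
    where
    open WF.All wf 0ℓ using (wfRec)

    descend : ∀ x → (∀ {y} → y < x → P y → ∃ (IsMinimal _<_ P)) → P x → ∃ (IsMinimal _<_ P)
    descend x ih x∈P with em₀ {∃ λ y → y < x × P y}
    ... | yes (y , y<x , y∈P) = ih y<x y∈P
    ... | no  ∄y              = x , x∈P , λ y<x y∈P → ∄y (-, y<x , y∈P)

  cantorNormalForm : ∀ {n α} → α <ₒ ω^ n → ∃ λ (d : Vec ℕ n) → α ≈ₒ ⟦ d ⟧
  cantorNormalForm {n} {α} α<ω^ with minimal ≺-wellFounded (λ d → α ≤ₒ ⟦ d ⟧) (ω^-cofinal n α<ω^)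
  ... | d , α≤d , d-minimal = d , α≤d , ≤ₒ-ext λ γ<d →
    let (e , e≺d , γ≤e) = ⟦⟧-cofinal d γ<d in ≤ₒ-<ₒ-trans γ≤e (≰ₒ⇒>ₒ (d-minimal e≺d))

  embedding⇒ranking : ∀ {A} {_<_ : Rel A 0ℓ} {n X} → Transitive _<_ →
                      Embedding {Σ A X} (_<_ on proj₁) n → Ranking _<_ (suc n) X
  embedding⇒ranking {A} {_<_} {n} {X} <-trans e = record
    { coeffs   = coeffs
    ; coeffs-≼ = λ {y} {x} y<x → ⟦⟧-cancel-≤ _ _ (begin
        ⟦ coeffs y ⟧  ≈⟨ heightBelow≈⟦coeffs⟧ y ⟨
        heightBelow y ≤⟨ heightBelow-mono y<x ⟩
        heightBelow x ≈⟨ heightBelow≈⟦coeffs⟧ x ⟩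
        ⟦ coeffs x ⟧  ∎)
    ; coeffs-≺ = λ {y} {x} y∈X y<x → ⟦⟧-cancel-< _ _ (begin-strict
        ⟦ coeffs y ⟧  ≈⟨ heightBelow≈⟦coeffs⟧ y ⟨
        heightBelow y <⟨ heightBelow-strict y∈X y<x ⟩
        heightBelow x ≈⟨ heightBelow≈⟦coeffs⟧ x ⟩
        ⟦ coeffs x ⟧  ∎)
    }
    where
    open ≤ₒ-Reasoning
    open Embedding e

    heightBelow : A → Ord
    heightBelow x = sup (Σ (Σ A X) λ (y , _) → y < x) (ord ∘ proj₁)

    heightBelow-mono : ∀ {y x} → y < x → heightBelow y ≤ₒ heightBelow x
    heightBelow-mono y<x (z , z<y) = (z , <-trans z<y y<x) , ≤ₒ-refl

    heightBelow-strict : ∀ {y x} → X y → y < x → heightBelow y <ₒ heightBelow x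
    heightBelow-strict y∈X y<x = ((-, y∈X) , y<x) , λ (_ , z<y) → ord-mono z<y

    heightBelow<ω^ : ∀ x → heightBelow x <ₒ ω^ (suc n)
    heightBelow<ω^ x = ≤ₒ-<ₒ-trans (λ (y , _) → ord<ω^ y) (ω^n<ω^1+n n)

    coeffs : A → Vec ℕ (suc n)
    coeffs x = proj₁ (cantorNormalForm (heightBelow<ω^ x))

    heightBelow≈⟦coeffs⟧ : ∀ x → heightBelow x ≈ₒ ⟦ coeffs x ⟧
    heightBelow≈⟦coeffs⟧ x = proj₂ (cantorNormalForm (heightBelow<ω^ x))

  uniformThreshold : ∀ {A} → Finite A → (P : A → ℕ → Set₁) → (∀ {a m n} → m ≤ n → P a m → P a n) →
                     ∃ λ M → ∀ a → ∃ (P a) → P a M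
  uniformThreshold {A} (n , Fin↔A) P P-mono = M , λ a →
    subst (λ a → ∃ (P a) → P a M) (strictlyInverseˡ a) (P-at-M (from a))
    where
    open Inverse Fin↔A using (to; from; strictlyInverseˡ)

    threshold : ∀ a → ∃ λ m → ∃ (P a) → P a m
    threshold a with em {∃ (P a)}
    ... | yes (m , Pam) = m , λ _ → Pam
    ... | no  ∄m        = 0 , ⊥-elim ∘ ∄m

    thresholds : List ℕ
    thresholds = tabulate (proj₁ ∘ threshold ∘ to)

    M : ℕ
    M = max 0 thresholds

    P-at-M : ∀ i → ∃ (P (to i)) → P (to i) M
    P-at-M i ∃m =
      P-mono (All.lookup (xs≤max 0 thresholds) (∈-tabulate⁺ i)) (proj₂ (threshold (to i)) ∃m)

-- Automata

conv-++ : ∀ {k} (u v : List (Fin k)) {w x} → length u ≡ length v →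
          conv (u ++ w) (v ++ x) ≡ conv u v ++ conv w x
conv-++ []      []      _       = refl
conv-++ (a ∷ u) (b ∷ v) |u|≡|v| = cong (_ ∷_) (conv-++ u v (cong pred |u|≡|v|))

length≡⇒++-identity : ∀ {A : Set} (u v : List A) {w} → length u ≡ length v → u ++ w ≡ v → w ≡ []
length≡⇒++-identity []      []      _       u++w≡v = u++w≡v
length≡⇒++-identity (_ ∷ u) (_ ∷ v) |u|≡|v| u++w≡v =
  length≡⇒++-identity u v (cong pred |u|≡|v|) (∷-injectiveʳ u++w≡v)

run : ∀ {A} (D : DFA A) → Fin (DFA.nStates D) → List A → Fin (DFA.nStates D)
run D = foldl (DFA.δ D)

acceptsFrom : ∀ {A} (D : DFA A) → Fin (DFA.nStates D) → List A → Bool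
acceptsFrom D q w = DFA.final D (run D q w)

accepts : ∀ {A} → DFA A → List A → Bool
accepts D = acceptsFrom D (DFA.start D)

acceptsFrom-++ : ∀ {A} (D : DFA A) q u w → acceptsFrom D q (u ++ w) ≡ acceptsFrom D (run D q u) w
acceptsFrom-++ D q u w = cong (DFA.final D) (foldl-++ (DFA.δ D) q u w)

foldl-fusion : ∀ {A S T : Set} (h : S → T) {f : S → A → S} {g : T → A → T} →
               (∀ s a → h (f s a) ≡ g (h s) a) → ∀ s w → h (foldl f s w) ≡ foldl g (h s) w
foldl-fusion h         h-hom s []      = refl
foldl-fusion h {f} {g} h-hom s (a ∷ w) =
  trans (foldl-fusion h h-hom (f s a) w) (cong (λ t → foldl g t w) (h-hom s a))

foldl-fixed : ∀ {A S : Set} {f : S → A → S} {s} → (∀ a → f s a ≡ s) → ∀ w → foldl f s w ≡ s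
foldl-fixed         fixed []      = refl
foldl-fixed {f = f} fixed (a ∷ w) =
  trans (cong (λ s → foldl f s w) (fixed a)) (foldl-fixed fixed w)

record Automaton (A : Set) : Set₁ where
  field
    {State}   : Set
    finite    : Finite State
    start     : State
    step      : State → A → State
    accepting : State → Bool

  recognises : List A → Bool
  recognises w = accepting (foldl step start w)

open Automaton using (recognises)

toDFA : ∀ {A} → Automaton A → DFA A
toDFA M = record
  { nStates = proj₁ finite
  ; start   = from start
  ; δ       = λ i a → from (step (to i) a)
  ; final   = accepting ∘ to
  }
  where
  open Automaton M
  open Inverse (proj₂ finite) using (to; from)

toDFA-accepts : ∀ {A} (M : Automaton A) w → accepts (toDFA M) w ≡ recognises M w
toDFA-accepts M w = cong accepting (begin
  to (run (toDFA M) (from start) w) ≡⟨ cong to (foldl-fusion from from-step start w) ⟨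
  to (from (foldl step start w))    ≡⟨ strictlyInverseˡ (foldl step start w) ⟩
  foldl step start w                ∎)
  where
  open Automaton M
  open Inverse (proj₂ finite) using (to; from; strictlyInverseˡ)
  open ≡-Reasoning

  from-step : ∀ s a → from (step s a) ≡ DFA.δ (toDFA M) (from s) a
  from-step s a = cong (λ t → from (step t a)) (sym (strictlyInverseˡ s))

Regular : ∀ {A} → Pred (List A) 0ℓ → Set
Regular L = ∃ λ D → ∀ w → Accepts D w ⇔ L w

Regular₂ : ∀ {k} → Rel (List (Fin k)) 0ℓ → Set
Regular₂ R = ∃ λ D → ∀ u v → Accepts D (conv u v) ⇔ R u v

regular : ∀ {A} {L : Pred (List A) 0ℓ} (M : Automaton A) →
          (∀ w → (recognises M w ≡ true) ⇔ L w) → Regular L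
regular M M⇔L = toDFA M , λ w → M⇔L w ⇔-∘ ≡⇒ (cong (_≡ true) (toDFA-accepts M w))

regular₂ : ∀ {k} {R : Rel (List (Fin k)) 0ℓ} (M : Automaton (Padded k × Padded k)) →
           (∀ u v → (recognises M (conv u v) ≡ true) ⇔ R u v) → Regular₂ R
regular₂ M M⇔R = toDFA M , λ u v → M⇔R u v ⇔-∘ ≡⇒ (cong (_≡ true) (toDFA-accepts M (conv u v)))

∩-regular : ∀ {A} {K L : Pred (List A) 0ℓ} → Regular K → Regular L → Regular (K ∩ L)
∩-regular {A} {K} {L} (D , D⇔K) (E , E⇔L) = regular product λ w → mk⇔ (to w) (from w)
  where
  module D = DFA D
  module E = DFA E

  product : Automaton A
  product = record
    { finite    = ×-finite Fin-finite Fin-finite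
    ; start     = D.start , E.start
    ; step      = λ (p , q) a → D.δ p a , E.δ q a
    ; accepting = λ (p , q) → D.final p ∧ E.final q
    }

  recognises-product : ∀ w → recognises product w ≡ accepts D w ∧ accepts E w
  recognises-product w = cong₂ (λ p q → D.final p ∧ E.final q)
    (foldl-fusion proj₁ (λ _ _ → refl) (D.start , E.start) w)
    (foldl-fusion proj₂ (λ _ _ → refl) (D.start , E.start) w)

  to : ∀ w → recognises product w ≡ true → (K ∩ L) w
  to w accepted =
    Equivalence.to (D⇔K w) (∧-conicalˡ _ _ both) , Equivalence.to (E⇔L w) (∧-conicalʳ _ _ both)
    where
    both : accepts D w ∧ accepts E w ≡ true
    both = trans (sym (recognises-product w)) accepted

  from : ∀ w → (K ∩ L) w → recognises product w ≡ true
  from w (w∈K , w∈L) = trans (recognises-product w)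
    (cong₂ _∧_ (Equivalence.from (D⇔K w) w∈K) (Equivalence.from (E⇔L w) w∈L))

module Section {k : ℕ} (D : DFA (Padded k × Padded k)) where

  open DFA D

  -- A state records how many letters of the parameter have been consumed, up to all of them.
  State : List (Fin k) → Set
  State []      = Fin nStates
  State (_ ∷ v) = Fin nStates ⊎ State v

  State-finite : ∀ v → Finite (State v)
  State-finite []      = Fin-finite
  State-finite (_ ∷ v) = ⊎-finite Fin-finite (State-finite v)

  enter : ∀ v → Fin nStates → State v
  enter []      q = q
  enter (_ ∷ v) q = inj₁ q

  step : ∀ v → State v → Fin k → State v
  step []      q        a = δ q (just a , nothing)
  step (b ∷ v) (inj₁ q) a = inj₂ (enter v (δ q (just a , just b)))
  step (b ∷ v) (inj₂ s) a = inj₂ (step v s a)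

  accepting : ∀ v → State v → Bool
  accepting []      q        = final q
  accepting (b ∷ v) (inj₁ q) = acceptsFrom D q (conv [] (b ∷ v))
  accepting (b ∷ v) (inj₂ s) = accepting v s

  section : List (Fin k) → Automaton (Fin k)
  section v = record
    { finite = State-finite v ; start = enter v start ; step = step v ; accepting = accepting v }

  accepting-foldl : ∀ v q u →
                    accepting v (foldl (step v) (enter v q) u) ≡ acceptsFrom D q (conv u v)
  accepting-foldl []      q []      = refl
  accepting-foldl []      q (a ∷ u) = accepting-foldl [] (δ q (just a , nothing)) u
  accepting-foldl (b ∷ v) q []      = refl
  accepting-foldl (b ∷ v) q (a ∷ u) = begin
    accepting (b ∷ v) (foldl (step (b ∷ v)) (inj₂ (enter v q′)) u)
      ≡⟨ cong (accepting (b ∷ v)) (foldl-fusion inj₂ (λ _ _ → refl) (enter v q′) u) ⟨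
    accepting v (foldl (step v) (enter v q′) u)
      ≡⟨ accepting-foldl v q′ u ⟩
    acceptsFrom D q′ (conv u v)
      ∎
    where
    open ≡-Reasoning

    q′ : Fin nStates
    q′ = δ q (just a , just b)

section-regular : ∀ {k} {R : Rel (List (Fin k)) 0ℓ} → Regular₂ R → ∀ v → Regular (λ u → R u v)
section-regular (D , D⇔R) v = regular (section v) λ u →
  D⇔R u v ⇔-∘ ≡⇒ (cong (_≡ true) (accepting-foldl v (DFA.start D) u))
  where open Section D

module LexComparison {k : ℕ} {_<ₐ_ : Rel (Fin k) 0ℓ} (cmp : Trichotomous _≡_ _<ₐ_) where

  infix 4 _⊑_

  _⊑_ : Rel (List (Fin k)) 0ℓ
  _⊑_ = ListLex.Lex-≤ _≡_ _<ₐ_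

  -- nothing: equal so far; just b: comparison decided, with result b.
  step : Maybe Bool → Padded k × Padded k → Maybe Bool
  step (just b) _                  = just b
  step nothing  (nothing , _)      = just true
  step nothing  (just _ , nothing) = just false
  step nothing  (just a , just b) with cmp a b
  ... | tri< _ _ _ = just true
  ... | tri≈ _ _ _ = nothing
  ... | tri> _ _ _ = just false

  comparison : Automaton (Padded k × Padded k)
  comparison = record
    { finite    = Maybe-finite Bool-finite
    ; start     = nothing
    ; step      = step
    ; accepting = fromMaybe true
    }

  step-just-fixed : ∀ b w → foldl step (just b) w ≡ just b
  step-just-fixed b = foldl-fixed (λ _ → refl)

  sound : ∀ u v → recognises comparison (conv u v) ≡ true → u ⊑ v
  sound []      []      _        = base tt
  sound []      (_ ∷ _) _        = halt
  sound (a ∷ u) []      accepted rewrite step-just-fixed false (conv u []) with () ← accepted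
  sound (a ∷ u) (b ∷ v) accepted with cmp a b
  ... | tri< a<b _ _ = this a<b
  ... | tri≈ _ a≡b _ = next a≡b (sound u v accepted)
  ... | tri> _ _ _ rewrite step-just-fixed false (conv u v) with () ← accepted

  complete : ∀ {u v} → u ⊑ v → recognises comparison (conv u v) ≡ true
  complete (base tt) = refl
  complete {v = _ ∷ v} halt rewrite step-just-fixed true (conv [] v) = refl
  complete {a ∷ u} {b ∷ v} (this a<b) with cmp a b
  ... | tri< _ _ _ rewrite step-just-fixed true (conv u v) = refl
  ... | tri≈ a≮b _ _ = ⊥-elim (a≮b a<b)
  ... | tri> a≮b _ _ = ⊥-elim (a≮b a<b)
  complete {a ∷ u} {b ∷ v} (next a≡b u⊑v) with cmp a b
  ... | tri< _ a≢b _ = ⊥-elim (a≢b a≡b)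
  ... | tri≈ _ _ _   = complete u⊑v
  ... | tri> _ a≢b _ = ⊥-elim (a≢b a≡b)

lex-regular : ∀ {k} {_<ₐ_ : Rel (Fin k) 0ℓ} → Trichotomous _≡_ _<ₐ_ →
              Regular₂ (ListLex.Lex-≤ _≡_ _<ₐ_)
lex-regular cmp = regular₂ comparison λ u v → mk⇔ (sound u v) complete
  where open LexComparison cmp

-- Heights of automatic well-founded partial orders

module UpperBound (em : ExcludedMiddle (Level.suc 0ℓ)) (P : AutomaticWFPO) where

  open Classical em
  open AutomaticWFPO P renaming (_<_ to _<ₚ_; _≤_ to _≤ₚ_)
  open Height _<ₚ_ wf< using (rank)
  open RankProperties wf< using (rank-mono)

  <ₚ-trans : Transitive _<ₚ_
  <ₚ-trans {x} {y} {z} (x≤y , x≢y) (y≤z , _) = trans≤ x y z x≤y y≤z , λ x≡z →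
    x≢y (antisym≤ x y x≤y (subst (λ w → Accepts Ord≤ (conv (proj₁ y) w)) (sym x≡z) y≤z))

  Word : Set
  Word = List (Fin k)

  word : Carrier → Word
  word = proj₁

  domState : Word → Fin (DFA.nStates Dom)
  domState = run Dom (DFA.start Dom)

  ordState : Word → Word → Fin (DFA.nStates Ord≤)
  ordState v u = run Ord≤ (DFA.start Ord≤) (conv v u)

  Kind : Set
  Kind = Fin (DFA.nStates Dom) × Fin (DFA.nStates Ord≤) × Fin (DFA.nStates Ord≤)

  kind : Word → Word → Kind
  kind v u = domState v , ordState v u , ordState v v

  -- For |v| = |u| the nonempty words w with v w ≤ u, compared through v w, depend only on kind v u.
  Piece : Kind → Set
  Piece (s , p , _) =
    Σ Word λ w → w ≢ [] × acceptsFrom Dom s w ≡ true × acceptsFrom Ord≤ p (conv w []) ≡ true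

  PieceOrder : ∀ κ → Rel (Piece κ) 0ℓ
  PieceOrder (_ , _ , q) (w , _) (x , _) = acceptsFrom Ord≤ q (conv w x) ≡ true × w ≢ x

  pieceThreshold : ∃ λ M → ∀ κ → ∃ (Embedding (PieceOrder κ)) → Embedding (PieceOrder κ) M
  pieceThreshold = uniformThreshold (×-finite Fin-finite (×-finite Fin-finite Fin-finite))
    (λ κ → Embedding (PieceOrder κ)) embedding-≤

  M : ℕ
  M = proj₁ pieceThreshold

  dom-++ : ∀ v {w} → accepts Dom (v ++ w) ≡ acceptsFrom Dom (domState v) w
  dom-++ v {w} = acceptsFrom-++ Dom (DFA.start Dom) v w

  ord-++ : ∀ v t {w x} → length v ≡ length t →
           accepts Ord≤ (conv (v ++ w) (t ++ x)) ≡
           acceptsFrom Ord≤ (ordState v t) (conv w x)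
  ord-++ v t {w} {x} |v|≡|t| =
    trans (cong (accepts Ord≤) (conv-++ v t |v|≡|t|))
          (acceptsFrom-++ Ord≤ (DFA.start Ord≤) (conv v t) (conv w x))

  EmbeddingBelow : Carrier → ℕ → Set₁
  EmbeddingBelow u = Embedding {Σ Carrier (_<ₚ u)} (_<ₚ_ on proj₁)

  module _ (u : Carrier) (embeddingBelow : EmbeddingBelow u (suc M)) where

    Extension ProperExtension : Word → Pred Carrier 0ℓ
    Extension       v x = x <ₚ u × ∃ λ w → word x ≡ v ++ w
    ProperExtension v x = x <ₚ u × ∃ λ w → w ≢ [] × word x ≡ v ++ w

    module _ (v : Word) (|v|≡|u| : length v ≡ length (word u)) where

      κ : Kind
      κ = kind v (word u)

      ord-u : ∀ {w} → accepts Ord≤ (conv (v ++ w) (word u)) ≡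
                      acceptsFrom Ord≤ (ordState v (word u)) (conv w [])
      ord-u {w} = subst (λ t → accepts Ord≤ (conv (v ++ w) t) ≡
                               acceptsFrom Ord≤ (ordState v (word u)) (conv w []))
                        (++-identityʳ (word u)) (ord-++ v (word u) |v|≡|u|)

      fromPiece : Piece κ → Σ Carrier (_<ₚ u)
      fromPiece (w , w≢[] , w∈dom , w≤u) =
        (v ++ w , trans (dom-++ v) w∈dom) , trans ord-u w≤u ,
        λ vw≡u → w≢[] (length≡⇒++-identity v (word u) |v|≡|u| vw≡u)

      fromPiece-mono : ∀ {a b} → PieceOrder κ a b → (_<ₚ_ on proj₁) (fromPiece a) (fromPiece b)
      fromPiece-mono (w≤x , w≢x) =
        trans (ord-++ v v refl) w≤x , λ vw≡vx → w≢x (++-cancelˡ v _ _ vw≡vx)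

      toPiece : Σ Carrier (ProperExtension v) → Piece κ
      toPiece ((_ , vw∈dom) , (vw≤u , _) , w , w≢[] , refl) =
        w , w≢[] , trans (sym (dom-++ v)) vw∈dom , trans (sym ord-u) vw≤u

      toPiece-mono : ∀ {a b} → (_<ₚ_ on proj₁) a b → PieceOrder κ (toPiece a) (toPiece b)
      toPiece-mono {_ , _ , _ , _ , refl} {_ , _ , _ , _ , refl} (vw≤vx , vw≢vx) =
        trans (sym (ord-++ v v refl)) vw≤vx , λ w≡x → vw≢vx (cong (v ++_) w≡x)

      embedding-piece : Embedding (PieceOrder κ) M
      embedding-piece = proj₂ pieceThreshold κ
        (suc M , embedding-∘ fromPiece (λ {a b} → fromPiece-mono {a} {b}) embeddingBelow)

      ranking-piece : Ranking _<ₚ_ (suc M) (ProperExtension v)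
      ranking-piece = embedding⇒ranking (λ {x y z} → <ₚ-trans {x} {y} {z})
        (embedding-∘ toPiece (λ {a b} → toPiece-mono {a} {b}) embedding-piece)

    ranking-singleton : ∀ v → Ranking _<ₚ_ (suc M) (λ x → word x ≡ v)
    ranking-singleton v = embedding⇒ranking (λ {x y z} → <ₚ-trans {x} {y} {z}) (record
      { ord      = λ _ → ⟦ replicate M 0 ⟧
      ; ord-mono = λ { {_ , y≡v} {_ , x≡v} (_ , y≢x) → ⊥-elim (y≢x (trans y≡v (sym x≡v))) }
      ; ord<ω^   = λ _ → ⟦⟧<ω^ (replicate M 0)
      })

    ranking-extension : ∀ j v → length v + j ≡ length (word u) →
                        Ranking _<ₚ_ (suc M) (Extension v)
    ranking-properExtension : ∀ j v → length v + j ≡ length (word u) →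
                              Ranking _<ₚ_ (suc M) (ProperExtension v)

    ranking-extension j v |v|+j≡|u| =
      ranking-⊆ (λ { (_ , [] , x≡v)             → inj₁ (trans x≡v (++-identityʳ v))
                   ; (x<u , w@(_ ∷ _) , x≡vw) → inj₂ (x<u , w , (λ ()) , x≡vw) })
        (ranking-∪ (ranking-singleton v) (ranking-properExtension j v |v|+j≡|u|))

    ranking-properExtension zero v |v|+0≡|u| =
      ranking-piece v (trans (sym (ℕ.+-identityʳ (length v))) |v|+0≡|u|)
    ranking-properExtension (suc j) v |v|+1+j≡|u| =
      ranking-⊆ (λ { (_ , [] , []≢[] , _)      → ⊥-elim ([]≢[] refl)
                   ; (x<u , a ∷ w , _ , x≡vaw) →
                       a , x<u , w , trans x≡vaw (sym (++-assoc v [ a ] w)) })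
        (ranking-⋃ λ a → ranking-extension j (v ++ [ a ]) (trans (|va|+j a) |v|+1+j≡|u|))
      where
      |va|+j : ∀ a → length (v ++ [ a ]) + j ≡ length v + suc j
      |va|+j a = trans (cong (_+ j) (length-++ v)) (ℕ.+-assoc (length v) 1 j)

    ranking-below : Ranking _<ₚ_ (suc M) (_<ₚ u)
    ranking-below = ranking-⊆ (λ {x} x<u → x<u , word x , refl)
      (ranking-extension (length (word u)) [] refl)

  rank<ω^ : ∀ u → rank u <ₒ ω^ (suc M)
  rank<ω^ = WF.All.wfRec wf< 0ℓ (λ u → rank u <ₒ ω^ (suc M)) λ u ih →
    ranking⇒rank<ω^ wf< (λ {x y z} → <ₚ-trans {x} {y} {z})
      (ranking-below u (record
        { ord      = rank ∘ proj₁
        ; ord-mono = λ {y x} → rank-mono {proj₁ y} {proj₁ x}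
        ; ord<ω^   = λ (_ , y<u) → ih y<u
        }))
      u id

  height<ω^ω : height <ₒ ω^ω
  height<ω^ω = suc M , λ (_ , y , _) → rank<ω^ y

-- Automatic orders of prescribed height

module Presentation {k : ℕ} {L : Pred (List (Fin k)) 0ℓ} {_⊑_ : Rel (List (Fin k)) 0ℓ}
  (L-regular : Regular L) (⊑-regular : Regular₂ _⊑_) where

  Carrier : Set
  Carrier = Σ (List (Fin k)) (Accepts (proj₁ L-regular))

  word∈L : ∀ ((w , _) : Carrier) → L w
  word∈L (w , w∈) = Equivalence.to (proj₂ L-regular w) w∈

  element : ∀ w → L w → Carrier
  element w w∈L = w , Equivalence.from (proj₂ L-regular w) w∈L

  _≤ₚ_ _<ₚ_ : Rel Carrier 0ℓ
  x ≤ₚ y = Accepts (proj₁ ⊑-regular) (conv (proj₁ x) (proj₁ y))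
  x <ₚ y = x ≤ₚ y × proj₁ x ≢ proj₁ y

  ≤ₚ⇒⊑ : ∀ x y → x ≤ₚ y → proj₁ x ⊑ proj₁ y
  ≤ₚ⇒⊑ (v , _) (w , _) = Equivalence.to (proj₂ ⊑-regular v w)

  ⊑⇒≤ₚ : ∀ x y → proj₁ x ⊑ proj₁ y → x ≤ₚ y
  ⊑⇒≤ₚ (v , _) (w , _) = Equivalence.from (proj₂ ⊑-regular v w)

  automaticWFPO : IsPartialOrder _≡_ _⊑_ → WellFounded _<ₚ_ → AutomaticWFPO
  automaticWFPO ⊑-isPartialOrder <ₚ-wellFounded = record
    { k        = k
    ; Dom      = proj₁ L-regular
    ; Ord≤     = proj₁ ⊑-regular
    ; refl≤    = λ x → ⊑⇒≤ₚ x x ⊑.refl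
    ; antisym≤ = λ x y x≤y y≤x → ⊑.antisym (≤ₚ⇒⊑ x y x≤y) (≤ₚ⇒⊑ y x y≤x)
    ; trans≤   = λ x y z x≤y y≤z → ⊑⇒≤ₚ x z (⊑.trans (≤ₚ⇒⊑ x y x≤y) (≤ₚ⇒⊑ y z y≤z))
    ; wf<      = <ₚ-wellFounded
    }
    where module ⊑ = IsPartialOrder ⊑-isPartialOrder

-- The word 1^a₁ 0 1^a₂ 0 … for the vector a₁ ∷ a₂ ∷ …
encode : ∀ {n} → Vec ℕ n → List (Fin 2)
encode []          = []
encode (zero ∷ v)  = 0F ∷ encode v
encode (suc a ∷ v) = 1F ∷ encode (a ∷ v)

Code : ℕ → Pred (List (Fin 2)) 0ℓ
Code n w = ∃ λ (v : Vec ℕ n) → encode v ≡ w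

encode-injective : ∀ {n} {u v : Vec ℕ n} → encode u ≡ encode v → u ≡ v
encode-injective {u = []}        {[]}        _     = refl
encode-injective {u = zero ∷ u}  {zero ∷ v}  eu≡ev =
  cong (zero ∷_) (encode-injective (∷-injectiveʳ eu≡ev))
encode-injective {u = suc a ∷ u} {suc b ∷ v} eu≡ev
  with refl ← encode-injective {u = a ∷ u} {b ∷ v} (∷-injectiveʳ eu≡ev) = refl

infix 4 _⊑_

_⊑_ : Rel (List (Fin 2)) 0ℓ
_⊑_ = ListLex.Lex-≤ _≡_ Fin._<_

⊑-isPartialOrder : IsPartialOrder _≡_ _⊑_
⊑-isPartialOrder = record
  { isPreorder = record
    { isEquivalence = isEquivalence
    ; reflexive     = λ { refl → Pointwise.refl }
    ; trans         = Pointwise.trans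
    }
  ; antisym = λ u⊑v v⊑u → ListPointwise.Pointwise-≡⇒≡ (Pointwise.antisym u⊑v v⊑u)
  }
  where
  module Pointwise = IsPartialOrder (ListLex.≤-isPartialOrder (Fin.<-isStrictPartialOrder {2}))

module ⊑ = IsPartialOrder ⊑-isPartialOrder

encode-mono : ∀ {n} {u v : Vec ℕ n} → u ≼ v → encode u ⊑ encode v
encode-mono                             (base tt)          = base tt
encode-mono {u = zero ∷ u}  {suc b ∷ v} (this _ _)         = this (s≤s z≤n)
encode-mono {u = suc a ∷ u} {suc b ∷ v} (this (s≤s a<b) _) =
  next refl (encode-mono {u = a ∷ u} {b ∷ v} (this a<b refl))
encode-mono {u = zero ∷ u}  {zero ∷ v}  (next refl u≼v)    = next refl (encode-mono u≼v)
encode-mono {u = suc a ∷ u} {suc a ∷ v} (next refl u≼v)    =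
  next refl (encode-mono {u = a ∷ u} {a ∷ v} (next refl u≼v))

code-zero-regular : Regular (Code 0)
code-zero-regular = regular emptyWord (λ w → mk⇔ (sound w) (complete w))
  where
  emptyWord : Automaton (Fin 2)
  emptyWord = record { finite = Bool-finite ; start = true ; step = λ _ _ → false ; accepting = id }

  sound : ∀ w → recognises emptyWord w ≡ true → Code 0 w
  sound []      _   = [] , refl
  sound (_ ∷ w) accepted
    rewrite foldl-fixed {f = Automaton.step emptyWord} (λ _ → refl) w with () ← accepted

  complete : ∀ w → Code 0 w → recognises emptyWord w ≡ true
  complete _ ([] , refl) = refl

code-suc-regular : ∀ {n} → Regular (Code n) → Regular (Code (suc n))
code-suc-regular {n} (D , D⇔Code) = regular skipOnes λ w → mk⇔ (sound w) (complete w)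
  where
  open DFA D

  -- nothing: still reading the leading ones.
  step : Maybe (Fin nStates) → Fin 2 → Maybe (Fin nStates)
  step nothing  0F = just start
  step nothing  1F = nothing
  step (just q) a  = just (δ q a)

  skipOnes : Automaton (Fin 2)
  skipOnes = record
    { finite    = Maybe-finite Fin-finite
    ; start     = nothing
    ; step      = step
    ; accepting = maybe′ final false
    }

  recognises-0∷ : ∀ w → recognises skipOnes (0F ∷ w) ≡ accepts D w
  recognises-0∷ w = cong (maybe′ final false) (sym (foldl-fusion just (λ _ _ → refl) start w))

  sound : ∀ w → recognises skipOnes w ≡ true → Code (suc n) w
  sound (0F ∷ w) accepted =
    let (v , ev≡w) = Equivalence.to (D⇔Code w) (trans (sym (recognises-0∷ w)) accepted) in
    zero ∷ v , cong (0F ∷_) ev≡w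
  sound (1F ∷ w) accepted with sound w accepted
  ... | a ∷ v , eav≡w = suc a ∷ v , cong (1F ∷_) eav≡w

  complete : ∀ w → Code (suc n) w → recognises skipOnes w ≡ true
  complete _ (zero ∷ v , refl)  =
    trans (recognises-0∷ (encode v)) (Equivalence.from (D⇔Code (encode v)) (v , refl))
  complete _ (suc a ∷ v , refl) = complete (encode (a ∷ v)) (a ∷ v , refl)

code-regular : ∀ n → Regular (Code n)
code-regular zero    = code-zero-regular
code-regular (suc n) = code-suc-regular (code-regular n)

CodeBelow : ∀ {n} → Vec ℕ n → Pred (List (Fin 2)) 0ℓ
CodeBelow {n} d = Code n ∩ (_⊑ encode d)

-- The regularity proofs are parameters because concrete ones would be unfolded by conversion checks.
module InitialSegment {n : ℕ} (d : Vec ℕ n)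
  (codeBelow-regular : Regular (CodeBelow d)) (⊑-regular : Regular₂ _⊑_) where

  open Presentation codeBelow-regular ⊑-regular

  ⊑-encode-d : ∀ x → proj₁ x ⊑ encode d
  ⊑-encode-d x = proj₂ (word∈L x)

  decode : Carrier → Vec ℕ n
  decode x = proj₁ (proj₁ (word∈L x))

  encode-decode : ∀ x → encode (decode x) ≡ proj₁ x
  encode-decode x = proj₂ (proj₁ (word∈L x))

  codeOf : ∀ v → encode v ⊑ encode d → Carrier
  codeOf v v⊑d = element (encode v) ((v , refl) , v⊑d)

  decode-codeOf : ∀ v v⊑d → decode (codeOf v v⊑d) ≡ v
  decode-codeOf v v⊑d = encode-injective (encode-decode (codeOf v v⊑d))

  decode-mono : ∀ y x → y <ₚ x → decode y ≺ decode x
  decode-mono y x (y≤x , y≢x) with ≺-or-≽ (decode y) (decode x)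
  ... | inj₁ y≺x = y≺x
  ... | inj₂ x≼y = ⊥-elim (y≢x (⊑.antisym (≤ₚ⇒⊑ y x y≤x)
    (subst₂ _⊑_ (encode-decode x) (encode-decode y) (encode-mono x≼y))))

  decode-lift : ∀ x {v} → v ≺ decode x → ∃ λ y → y <ₚ x × decode y ≡ v
  decode-lift x {v} v≺x = y , (⊑⇒≤ₚ y x v⊑x , v≢x) , decode-codeOf v _
    where
    v⊑x : encode v ⊑ proj₁ x
    v⊑x = subst (encode v ⊑_) (encode-decode x) (encode-mono (VecLex.<⇒≤ v≺x))

    y : Carrier
    y = codeOf v (⊑.trans v⊑x (⊑-encode-d x))

    v≢x : encode v ≢ proj₁ x
    v≢x v≡x with refl ← encode-injective (trans v≡x (sym (encode-decode x))) =
      VecLex.<-irrefl ℕ.<-irrefl (VecPointwise.refl refl) v≺x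

  <ₚ-wellFounded : WellFounded _<ₚ_
  <ₚ-wellFounded =
    WF.Subrelation.wellFounded (λ {y x} → decode-mono y x) (On.wellFounded decode ≺-wellFounded)

  segment : AutomaticWFPO
  segment = automaticWFPO ⊑-isPartialOrder <ₚ-wellFounded

  open RankProperties <ₚ-wellFounded
  open Height _<ₚ_ <ₚ-wellFounded using (rank)

  rank≈⟦decode⟧ : ∀ x → rank x ≈ₒ ⟦ decode x ⟧
  rank≈⟦decode⟧ x =
    rank≤mono (⟦_⟧ ∘ decode) (λ {y x} _ y<x → tt , ⟦⟧-mono-< (decode-mono y x y<x)) tt ,
    cofinal≤rank (⟦_⟧ ∘ decode) ⟦decode⟧-cofinal x
    where
    ⟦decode⟧-cofinal : ∀ x {γ} → γ <ₒ ⟦ decode x ⟧ → ∃ λ y → y <ₚ x × γ ≤ₒ ⟦ decode y ⟧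
    ⟦decode⟧-cofinal x γ<x with ⟦⟧-cofinal (decode x) γ<x
    ... | v , v≺x , γ≤v with decode-lift x v≺x
    ...   | y , y<x , refl = y , y<x , γ≤v

  top : Carrier
  top = codeOf d ⊑.refl

  <ₚ⇒<ₚtop : ∀ y x → y <ₚ x → y <ₚ top
  <ₚ⇒<ₚtop y x (y≤x , y≢x) = ⊑⇒≤ₚ y top (⊑-encode-d y) , λ y≡d →
    y≢x (⊑.antisym (≤ₚ⇒⊑ y x y≤x) (subst (proj₁ x ⊑_) (sym y≡d) (⊑-encode-d x)))

  height≈⟦d⟧ : AutomaticWFPO.height segment ≈ₒ ⟦ d ⟧
  height≈⟦d⟧ = ≈ₒ.trans (height≈rank-maximum top (λ {y x} → <ₚ⇒<ₚtop y x))
    (subst (λ v → rank top ≈ₒ ⟦ v ⟧) (decode-codeOf d ⊑.refl) (rank≈⟦decode⟧ top))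

⟦⟧-isAutomaticHeight : ∀ {n} (d : Vec ℕ n) → Σ AutomaticWFPO λ P → AutomaticWFPO.height P ≈ₒ ⟦ d ⟧
⟦⟧-isAutomaticHeight {n} d = segment , height≈⟦d⟧
  where
  ⊑-regular : Regular₂ _⊑_
  ⊑-regular = lex-regular Fin.<-cmp

  codeBelow-regular : Regular (CodeBelow d)
  codeBelow-regular = ∩-regular (code-regular n) (section-regular ⊑-regular (encode d))

  open InitialSegment d codeBelow-regular ⊑-regular

theorem1 : ExcludedMiddle (Level.suc 0ℓ) →
    (α : Ord) →
    (Σ AutomaticWFPO (λ P → AutomaticWFPO.height P ≈ₒ α)) ⇔ (α <ₒ ω^ω)
theorem1 em α = mk⇔ bounded realised
  where
  open Classical em using (cantorNormalForm)

  bounded : Σ AutomaticWFPO (λ P → AutomaticWFPO.height P ≈ₒ α) → α <ₒ ω^ω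
  bounded (P , _ , α≤height) = ≤ₒ-<ₒ-trans α≤height (UpperBound.height<ω^ω em P)

  realised : α <ₒ ω^ω → Σ AutomaticWFPO (λ P → AutomaticWFPO.height P ≈ₒ α)
  realised (n , α≤ω^n) =
    let (d , α≈d) = cantorNormalForm {suc n} (≤ₒ-<ₒ-trans α≤ω^n (ω^n<ω^1+n n))
        (P , height≈d) = ⟦⟧-isAutomaticHeight d
    in P , ≈ₒ.trans height≈d (≈ₒ.sym α≈d)
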